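{- Let $G$ be a connected edge-stable equimatchable graph that has a cut vertex. Then $G$ is bipartite.
   Context: All graphs are finite and simple. A graph is equimatchable if all its maximal matchings have the same cardinality. An equimatchable graph $G$ is edge-stable if $G\setminus e$ (remove the edge $e$, keep all vertices) is equimatchable for every $e\in E(G)$. A cut vertex of a connected graph is a vertex whose removal disconnects the graph. -}

module Defs where

open import Data.Fin using (Fin; punchIn)
open import Data.Fin.Properties using (_≟_)
open import Data.Fin.Subset using (Subset; ∁) renaming (_∈_ to _∈ˢ_)
open import Data.List using (List; length)
open import Data.List.Relation.Unary.All using (All)
open import Data.List.Relation.Unary.AllPairs using (AllPairs)
open import Data.List.Relation.Unary.Any using (Any)
open import Data.Nat using (ℕ; suc)
open import Data.Product using (_×_; _,_; ∃-syntax; swap)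
open import Data.Product.Properties using (≡-dec)
open import Data.Sum using (_⊎_; inj₁; inj₂)
open import Level using (0ℓ)
open import Relation.Binary using (Rel; Decidable; Symmetric; Irreflexive)
open import Relation.Binary.Construct.Closure.ReflexiveTransitive using (Star)
open import Relation.Binary.PropositionalEquality using (_≡_; _≢_; refl; cong)
open import Relation.Nullary using (¬_)
open import Relation.Nullary.Decidable using (_×-dec_; _⊎-dec_; ¬?)

-- The field adj? makes the edge set a genuine finite set constructively.
record Graph (n : ℕ) : Set₁ where
  field
    Adj    : Rel (Fin n) 0ℓ
    adj?   : Decidable Adj
    sym    : Symmetric Adj
    irrefl : Irreflexive _≡_ Adj

open Graph

private
  variable
    n : ℕ

-- The unordered pair {u , v} is represented by either of (u , v) and
-- (v , u); the two are identified by _≈_.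
Pair : ℕ → Set
Pair n = Fin n × Fin n

infix 4 _≈_ _≈?_ _∈_ _⊆_

_≈_ : Rel (Pair n) 0ℓ
e ≈ f = e ≡ f ⊎ e ≡ swap f

_≈?_ : Decidable (_≈_ {n})
e ≈? f = ≡-dec _≟_ _≟_ e f ⊎-dec ≡-dec _≟_ _≟_ e (swap f)

IsEdge : Graph n → Pair n → Set
IsEdge G (u , v) = Adj G u v

infixl 6 _∖_ _-_

_∖_ : Graph n → Pair n → Graph n
(G ∖ e) .Adj u v        = Adj G u v × ¬ ((u , v) ≈ e)
(G ∖ e) .adj? u v       = adj? G u v ×-dec ¬? ((u , v) ≈? e)
(G ∖ e) .sym (a , ne)   = sym G a , λ where
  (inj₁ refl) → ne (inj₂ refl)
  (inj₂ p)    → ne (inj₁ (cong swap p))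
(G ∖ e) .irrefl p (a , _) = irrefl G p a

-- punchIn v enumerates the vertices other than v.
_-_ : Graph (suc n) → Fin (suc n) → Graph n
(G - v) .Adj i j       = Adj G (punchIn v i) (punchIn v j)
(G - v) .adj? i j      = adj? G (punchIn v i) (punchIn v j)
(G - v) .sym           = sym G
(G - v) .irrefl refl   = irrefl G refl

-- The graph without vertices counts as connected, so the single vertex
-- of K₁ is not a cut vertex.
Connected : Graph n → Set
Connected G = ∀ u v → Star (Adj G) u v

IsCutVertex : Graph n → Fin n → Set
IsCutVertex {suc _} G v = ¬ Connected (G - v)

Disjoint : Rel (Pair n) 0ℓ
Disjoint (u , v) (x , y) = u ≢ x × u ≢ y × v ≢ x × v ≢ y

-- Pairwise disjointness rules out repeated edges, so the cardinality of
-- a matching is the length of the list.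
IsMatching : Graph n → List (Pair n) → Set
IsMatching G M = All (IsEdge G) M × AllPairs Disjoint M

_∈_ : Pair n → List (Pair n) → Set
e ∈ M = Any (e ≈_) M

_⊆_ : Rel (List (Pair n)) 0ℓ
M ⊆ N = All (_∈ N) M

IsMaximalMatching : Graph n → List (Pair n) → Set
IsMaximalMatching G M =
  IsMatching G M × (∀ N → IsMatching G N → M ⊆ N → N ⊆ M)

Equimatchable : Graph n → Set
Equimatchable G =
  ∀ M N → IsMaximalMatching G M → IsMaximalMatching G N → length M ≡ length N

EdgeStable : Graph n → Set
EdgeStable G = ∀ e → IsEdge G e → Equimatchable (G ∖ e)

Independent : Graph n → Subset n → Set
Independent G A = ∀ {u v} → u ∈ˢ A → v ∈ˢ A → ¬ Adj G u v

Bipartite : Graph n → Set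
Bipartite G = ∃[ A ] (Independent G A × Independent G (∁ A))

{-# OPTIONS --safe #-}

-- Call a vertex essential if every maximum matching covers it.  Edge-stability
-- means that a maximum matching containing uv always misses a neighbour of u
-- or of v.  Exchanging at most three edges of a maximum matching then shows
-- that essential vertices are pairwise non-adjacent and that a vertex at the
-- end of a walk of length two from an essential vertex is essential.  So one
-- essential vertex in a connected graph gives the bipartition into essential
-- and inessential vertices.  If the cut vertex c is not essential, both parts
-- S of G - c still have the two properties inside G[S], and the neighbours of
-- c in S are essential in G[S]; the vertices essential in their own part form
-- one colour class, and c lies in the other.
module Submission where

open import Defs
open import Data.Empty using (⊥; ⊥-elim)
open import Data.Fin using (Fin; punchIn; punchOut)
open import Data.Fin.Properties using (_≟_; all?; any?; sequence; punchInᵢ≢i; punchIn-injective; punchIn-punchOut)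
open import Data.Fin.Subset using (∁) renaming (_∈_ to _∈ˢ_)
open import Data.Fin.Subset.Properties using (_∈?_; anySubset?; x∈∁p⇒x∉p)
open import Data.List using (List; []; _∷_; _++_; length; allFin; cartesianProduct)
open import Data.List.Membership.Propositional using (find; lose) renaming (_∈_ to _∈ₗ_)
open import Data.List.Membership.Propositional.Properties using (∈-allFin; ∈-cartesianProduct⁺)
open import Data.List.Properties using (length-++)
open import Data.List.Relation.Unary.All as All using (All; []; _∷_)
import Data.List.Relation.Unary.All.Properties as All
open import Data.List.Relation.Unary.AllPairs using (AllPairs; []; _∷_)
open import Data.List.Relation.Unary.Any using (Any; here; there)
open import Data.Nat using (ℕ; suc; _+_; _≤_; _<_)
open import Data.Nat.Properties using (≤-refl; ≤-trans; ≤-reflexive; <-irrefl; n≤1+n; +-suc; +-monoˡ-<; +-cancelʳ-≤)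
open import Data.Product using (∃; ∃₂; ∃-syntax; _×_; _,_; proj₁; proj₂)
open import Data.Sum using (_⊎_; inj₁; inj₂; [_,_]′)
open import Data.Vec using (tabulate)
open import Data.Vec.Properties using (lookup∘tabulate; lookup⇒[]=; []=⇒lookup)
open import Effect.Monad using (RawMonad)
open import Function using (_∘_; case_of_)
open import Level using (0ℓ)
open import Relation.Binary.Construct.Closure.ReflexiveTransitive using (Star; ε; _◅_; _◅◅_)
open import Relation.Binary.PropositionalEquality using (_≡_; _≢_; refl; sym; trans; cong; subst; ≢-sym)
open import Relation.Nullary using (¬_; Dec; yes; no; does)
open import Relation.Nullary.Decidable using (_×-dec_; _⊎-dec_; _→-dec_; ¬?; map′; ¬¬-excluded-middle; decidable-stable; dec-true)
open import Relation.Nullary.Negation using (¬¬-Monad)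
open import Relation.Unary using (Pred; Decidable)

open Graph using (Adj; adj?; irrefl) renaming (sym to Adj-sym)

private
  variable
    n : ℕ

-- Missed vertices and greedy extension of matchings.

Misses : List (Pair n) → Fin n → Set
Misses M v = All (λ e → v ≢ proj₁ e × v ≢ proj₂ e) M

misses? : ∀ (M : List (Pair n)) v → Dec (Misses M v)
misses? M v = All.all? (λ e → ¬? (v ≟ proj₁ e) ×-dec ¬? (v ≟ proj₂ e)) M

-- Maximality tested edge by edge; `saturated⇒maximal` turns it into maximality under inclusion.
Saturated : Graph n → List (Pair n) → Set
Saturated G M = ∀ {x y} → Adj G x y → Misses M x → Misses M y → ⊥

Adj⇒≢ : ∀ (G : Graph n) {u v} → Adj G u v → u ≢ v
Adj⇒≢ G a p = irrefl G p a

module _ (G : Graph n) where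

  insert : ∀ {u v M} → Adj G u v → Misses M u → Misses M v → IsMatching G M → IsMatching G ((u , v) ∷ M)
  insert a mu mv (es , ds) =
    a ∷ es , All.zipWith (λ ((p , q) , (r , s)) → p , q , r , s) (mu , mv) ∷ ds

  uncons : ∀ {u v M} → IsMatching G ((u , v) ∷ M) → Adj G u v × Misses M u × Misses M v × IsMatching G M
  uncons (a ∷ es , d ∷ ds) =
    a , All.map (λ (p , q , _) → p , q) d , All.map (λ (_ , _ , r , s) → r , s) d , es , ds

  empty : IsMatching G []
  empty = [] , []

  -- Prepares the edge at `v` for an exchange. Edges are only reordered or reversed, so missed
  -- vertices stay missed.
  pull : ∀ {v} M → IsMatching G M → ¬ Misses M v →
    ∃₂ λ w M′ → IsMatching G ((v , w) ∷ M′) × length M ≡ suc (length M′) ×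
      (∀ {x} → Misses M x → Misses ((v , w) ∷ M′) x)
  pull [] m ¬mv = ⊥-elim (¬mv [])
  pull {v} ((x , y) ∷ M) m ¬mv with v ≟ x | v ≟ y | uncons m
  ... | yes refl | _ | _ = y , M , m , refl , (λ z → z)
  ... | no _ | yes refl | a , mx , my , m′ =
    x , M , insert (Adj-sym G a) my mx m′ , refl ,
    (λ { ((p , q) ∷ r) → (q , p) ∷ r })
  ... | no v≢x | no v≢y | a , mx , my , m′
    with pull {v} M m′ (λ mv → ¬mv ((v≢x , v≢y) ∷ mv))
  ... | w , M′ , m″ , len , to with uncons m″ | to mx | to my
  ... | b , mv , mw , m‴ | (x≢v , x≢w) ∷ mx′ | (y≢v , y≢w) ∷ my′ =
    w , (x , y) ∷ M′ ,
    insert b ((v≢x , v≢y) ∷ mv) ((≢-sym x≢w , ≢-sym y≢w) ∷ mw) (insert a mx′ my′ m‴) ,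
    cong suc len ,
    (λ { (p ∷ r) → case to r of λ { (q ∷ r′) → q ∷ p ∷ r′ } })

  -- A pair refused at its turn stays refused: the matching only gains edges, so a vertex missed at
  -- the end was missed at that turn.
  greedy : ∀ (es : List (Pair _)) M → IsMatching G M → ∃ λ N → IsMatching G N ×
    (∀ {x} → Misses N x → Misses M x) × length M ≤ length N ×
    All (λ (x , y) → Adj G x y → Misses N x → Misses N y → ⊥) es
  greedy [] M m = M , m , (λ z → z) , ≤-refl , []
  greedy ((x , y) ∷ es) M m with adj? G x y ×-dec misses? M x ×-dec misses? M y
  ... | yes (a , mx , my) =
    let N , mN , back , len , sat = greedy es ((x , y) ∷ M) (insert a mx my m) in
    N , mN , (λ z → All.tail (back z)) , ≤-trans (n≤1+n _) len ,
    (λ _ z _ → proj₁ (All.head (back z)) refl) ∷ sat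
  ... | no ¬p =
    let N , mN , back , len , sat = greedy es M m in
    N , mN , back , len , (λ a z z′ → ¬p (a , back z , back z′)) ∷ sat

  saturate : ∀ M → IsMatching G M → ∃ λ N → IsMatching G N ×
    (∀ {x} → Misses N x → Misses M x) × length M ≤ length N × Saturated G N
  saturate M m =
    let N , mN , back , len , sat = greedy (cartesianProduct (allFin _) (allFin _)) M m in
    N , mN , back , len ,
    λ {x} {y} → All.lookup sat (∈-cartesianProduct⁺ (∈-allFin x) (∈-allFin y))

-- Saturated matchings are maximal.

Touches : Fin n → Pair n → Set
Touches v (x , y) = v ≡ x ⊎ v ≡ y

covered : ∀ {v} (M : List (Pair n)) → ¬ Misses M v → Any (Touches v) M
covered [] ¬m = ⊥-elim (¬m [])
covered {v = v} ((x , y) ∷ M) ¬m with v ≟ x | v ≟ y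
... | yes p | _     = here (inj₁ p)
... | no _  | yes q = here (inj₂ q)
... | no p  | no q  = there (covered M (λ m → ¬m ((p , q) ∷ m)))

equal-or-disjoint : ∀ {N : List (Pair n)} {e f} → AllPairs Disjoint N → e ∈ₗ N → f ∈ₗ N → e ≡ f ⊎ Disjoint e f
equal-or-disjoint (d ∷ ds) (here refl) (here refl) = inj₁ refl
equal-or-disjoint (d ∷ ds) (here refl) (there j) = inj₂ (All.lookup d j)
equal-or-disjoint (d ∷ ds) (there i) (here refl) =
  let p , q , r , s = All.lookup d i in inj₂ (≢-sym p , ≢-sym r , ≢-sym q , ≢-sym s)
equal-or-disjoint (d ∷ ds) (there i) (there j) = equal-or-disjoint ds i j

touching : ∀ {v} {N : List (Pair n)} {e f} → AllPairs Disjoint N → e ∈ₗ N → f ∈ₗ N →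
  Touches v e → Touches v f → e ≡ f
touching ds i j te tf with equal-or-disjoint ds i j
... | inj₁ p = p
touching ds i j (inj₁ refl) (inj₁ refl) | inj₂ (p , q , r , s) = ⊥-elim (p refl)
touching ds i j (inj₁ refl) (inj₂ refl) | inj₂ (p , q , r , s) = ⊥-elim (q refl)
touching ds i j (inj₂ refl) (inj₁ refl) | inj₂ (p , q , r , s) = ⊥-elim (r refl)
touching ds i j (inj₂ refl) (inj₂ refl) | inj₂ (p , q , r , s) = ⊥-elim (s refl)

≈-sym : {e f : Pair n} → e ≈ f → f ≈ e
≈-sym (inj₁ refl) = inj₁ refl
≈-sym (inj₂ refl) = inj₂ refl

≈-touches : ∀ {v} {e f : Pair n} → e ≈ f → Touches v e → Touches v f
≈-touches (inj₁ refl) t        = t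
≈-touches (inj₂ refl) (inj₁ p) = inj₂ p
≈-touches (inj₂ refl) (inj₂ p) = inj₁ p

-- By saturation an edge of `N` has an end covered by `M`. The edge of `M` there also occurs in `N`,
-- possibly reversed, and edges of `N` sharing an end coincide.
saturated⇒maximal : ∀ (G : Graph n) {M} → IsMatching G M → Saturated G M → IsMaximalMatching G M
saturated⇒maximal G {M} m sat = m , λ N (es , ds) M⊆N →
  let meets : ∀ {v e} → e ∈ₗ N → Touches v e → ¬ Misses M v → e ∈ M
      meets i t ¬mv =
        let f , f∈M , t′ = find (covered M ¬mv)
            g , g∈N , f≈g = find (All.lookup M⊆N f∈M)
        in lose f∈M (subst (_≈ f) (touching ds g∈N i (≈-touches f≈g t′) t) (≈-sym f≈g))
  in All.tabulate λ { {x , y} i → case misses? M x of λ where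
       (no ¬mx) → meets i (inj₁ refl) ¬mx
       (yes mx) → case misses? M y of λ where
         (no ¬my) → meets i (inj₂ refl) ¬my
         (yes my) → ⊥-elim (sat (All.lookup es i) mx my) }

-- Robust graphs and their essential vertices.

-- What the exchange arguments use of equimatchability and edge-stability, phrased without
-- connectivity so that the parts of `G - c` can inherit it.
record Robust (G : Graph n) (ν : ℕ) : Set where
  field
    attained    : ∃ λ M → IsMatching G M × length M ≡ ν
    bound       : ∀ {M} → IsMatching G M → length M ≤ ν
    augment     : ∀ {M} → IsMatching G M → length M < ν → ∃₂ λ x y → Adj G x y × Misses M x × Misses M y
    -- Otherwise `M` would be maximal once uv is deleted, with one edge too few.
    noncritical : ∀ {u v M} → IsMatching G ((u , v) ∷ M) → suc (length M) ≡ ν →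
      ¬ (∀ w → Misses ((u , v) ∷ M) w → ¬ Adj G u w × ¬ Adj G v w)

  maximum⇒saturated : ∀ {M} → IsMatching G M → length M ≡ ν → Saturated G M
  maximum⇒saturated m len a mx my =
    <-irrefl refl (≤-trans (≤-reflexive (cong suc (sym len))) (bound (insert G a mx my m)))

Essential : Graph n → ℕ → Fin n → Set
Essential G ν v = ∀ {M} → IsMatching G M → length M ≡ ν → ¬ Misses M v

module _ {G : Graph n} {ν : ℕ} (robust : Robust G ν) where
  open Robust robust

  -- A maximum matching missing `d` covers `a` by an edge ar. Unless `s` is `r` or is missed, which
  -- ends at once, it covers `s` by an edge sp. Exchanges then make pd, as and `N₂` a maximum
  -- matching whose missed vertices are all non-adjacent to `p` and `d`.
  essential-step₂ : ∀ {a s d} → Essential G ν a → Adj G a s → Adj G s d → Essential G ν d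
  essential-step₂ {a} {s} {d} ess a~s s~d {N} mN lenN Nd = contra
    where
    a≢s = Adj⇒≢ G a~s
    s≢d = Adj⇒≢ G s~d

    a≢d : a ≢ d
    a≢d refl = ess mN lenN Nd

    contra : ⊥
    contra with pull G N mN (ess mN lenN)
    ... | r , N₁ , mar , len₁ , to₁ with uncons G mar | to₁ Nd | trans (sym len₁) lenN
    ... | a~r , N₁a , N₁r , m₁ | (d≢a , d≢r) ∷ N₁d | len₁′ with s ≟ r | misses? N₁ s
    -- Trading as for sd frees `a`.
    ... | yes refl | _ = ess (insert G s~d N₁r N₁d m₁) len₁′ ((a≢s , a≢d) ∷ N₁a)
    ... | no s≢r | yes N₁s =
      maximum⇒saturated mar len₁′ s~d ((≢-sym a≢s , s≢r) ∷ N₁s) ((d≢a , d≢r) ∷ N₁d)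
    ... | no s≢r | no ¬N₁s with pull G N₁ m₁ ¬N₁s
    ... | p , N₂ , msp , len₂ , to₂
      with uncons G msp | to₂ N₁a | to₂ N₁r | to₂ N₁d | trans (cong suc (sym len₂)) len₁′
    ... | s~p , N₂s , N₂p , m₂ | (_ , a≢p) ∷ N₂a | (_ , r≢p) ∷ N₂r | (_ , d≢p) ∷ N₂d | len =
      noncritical final len λ w miss → p-isolated w miss , d-isolated w miss
      where
      a≢r = Adj⇒≢ G a~r
      s≢p = Adj⇒≢ G s~p

      -- N₂ together with ar and sp, that is, N up to order.
      m : IsMatching G ((a , r) ∷ (s , p) ∷ N₂)
      m = insert G a~r ((a≢s , a≢p) ∷ N₂a) ((≢-sym s≢r , r≢p) ∷ N₂r) msp

      msd : IsMatching G ((s , d) ∷ N₂)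
      msd = insert G s~d N₂s N₂d m₂

      mas : IsMatching G ((a , s) ∷ N₂)
      mas = insert G a~s N₂a N₂s m₂

      -- Otherwise dr, sp and `N₂` would form a maximum matching missing `a`.
      d≁r : ¬ Adj G d r
      d≁r d~r = ess (insert G d~r ((≢-sym s≢d , d≢p) ∷ N₂d) ((≢-sym s≢r , r≢p) ∷ N₂r) msp) len
        ((a≢d , a≢r) ∷ (a≢s , a≢p) ∷ N₂a)

      mate-of-d : ∀ {w} → Adj G d w → Misses ((a , s) ∷ N₂) w → w ≡ p
      mate-of-d {w} d~w ((w≢a , w≢s) ∷ N₂w) with w ≟ p | w ≟ r
      ... | yes w≡p | _      = w≡p
      ... | no _   | yes refl = ⊥-elim (d≁r d~w)
      ... | no w≢p | no w≢r  = ⊥-elim (maximum⇒saturated m len d~w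
        ((d≢a , d≢r) ∷ (≢-sym s≢d , d≢p) ∷ N₂d) ((w≢a , w≢r) ∷ (w≢s , w≢p) ∷ N₂w))

      -- as and `N₂` are one edge short, so some edge extends them. If it avoided `d`, then with sd
      -- and `N₂` it would form a maximum matching missing `a`; so it ends in `d`, and `mate-of-d`
      -- identifies its other end.
      d~p : Adj G d p
      d~p with augment mas (≤-reflexive len)
      ... | x , y , x~y , x∉ , y∉ with x ≟ d | y ≟ d
      ... | yes refl | _ = subst (Adj G d) (mate-of-d x~y y∉) x~y
      ... | no _ | yes refl = subst (Adj G d) (mate-of-d (Adj-sym G x~y) x∉) (Adj-sym G x~y)
      d~p | x , y , x~y , (x≢a , x≢s) ∷ N₂x , (y≢a , y≢s) ∷ N₂y | no x≢d | no y≢d =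
        ⊥-elim (ess (insert G x~y ((x≢s , x≢d) ∷ N₂x) ((y≢s , y≢d) ∷ N₂y) msd) len
          ((≢-sym x≢a , ≢-sym y≢a) ∷ (a≢s , a≢d) ∷ N₂a))

      final : IsMatching G ((p , d) ∷ (a , s) ∷ N₂)
      final = insert G (Adj-sym G d~p) ((≢-sym a≢p , ≢-sym s≢p) ∷ N₂p) ((d≢a , ≢-sym s≢d) ∷ N₂d) mas

      d-isolated : ∀ w → Misses ((p , d) ∷ (a , s) ∷ N₂) w → ¬ Adj G d w
      d-isolated w ((w≢p , _) ∷ miss) d~w = w≢p (mate-of-d d~w miss)

      p-isolated : ∀ w → Misses ((p , d) ∷ (a , s) ∷ N₂) w → ¬ Adj G p w
      p-isolated w ((w≢p , w≢d) ∷ (w≢a , w≢s) ∷ N₂w) p~w with w ≟ r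
      -- pr, sd and `N₂` would miss `a`.
      ... | yes refl = ess
        (insert G p~w ((≢-sym s≢p , ≢-sym d≢p) ∷ N₂p) ((w≢s , w≢d) ∷ N₂w) msd) len
        ((a≢p , a≢r) ∷ (a≢s , a≢d) ∷ N₂a)
      -- ar, sd and `N₂` form a maximum matching missing both `p` and `w`.
      ... | no w≢r = maximum⇒saturated
        (insert G a~r ((a≢s , a≢d) ∷ N₂a) ((≢-sym s≢r , ≢-sym d≢r) ∷ N₂r) msd) len p~w
        ((≢-sym a≢p , ≢-sym r≢p) ∷ (≢-sym s≢p , ≢-sym d≢p) ∷ N₂p)
        ((w≢a , w≢r) ∷ (w≢s , w≢d) ∷ N₂w)

  -- In a maximum matching with edge ww′, a missed neighbour of `w` or `w′` is two steps from `z` or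
  -- `w`, hence essential, which is absurd. Having no such neighbour contradicts `noncritical`.
  essential-independent : ∀ {z w} → Essential G ν z → Essential G ν w → ¬ Adj G z w
  essential-independent {z} {w} ez ew z~w with attained
  ... | M , m , len with pull G M m (ew m len)
  ... | w′ , M′ , m′ , len′ , _ = noncritical m′ lenM λ y miss →
    (λ w~y  → essential-step₂ ez z~w w~y m′ lenM miss) ,
    (λ w′~y → essential-step₂ ew (proj₁ (uncons G m′)) w′~y m′ lenM miss)
    where lenM = trans (sym len′) len

-- Robustness from connectivity, equimatchability and edge-stability.

exit : ∀ (G : Graph n) {P : Pred (Fin n) 0ℓ} → Decidable P → ∀ {x t} → P x → ¬ P t → Star (Adj G) x t →
  ∃₂ λ y w → P y × ¬ P w × Adj G y w
exit G P? px ¬pt ε = ⊥-elim (¬pt px)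
exit G P? px ¬pt (_◅_ {j = j} a as) with P? j
... | yes pj = exit G P? pj ¬pt as
... | no ¬pj = _ , j , px , ¬pj , a

Avoids : Fin n → Fin n → Fin n → Set
Avoids u v t = t ≢ u × t ≢ v

avoid : ∀ {p q r : Fin n} → p ≢ q → p ≢ r → q ≢ r → ∀ u v → ∃ (Avoids u v)
avoid {p = p} {q} {r} p≢q p≢r q≢r u v with p ≟ u | p ≟ v | q ≟ u | q ≟ v
... | no a | no b | _ | _ = p , a , b
... | _ | _ | no a | no b = q , a , b
... | yes refl | _ | yes refl | _ = ⊥-elim (p≢q refl)
... | _ | yes refl | _ | yes refl = ⊥-elim (p≢q refl)
... | yes refl | _ | _ | yes refl = r , ≢-sym p≢r , ≢-sym q≢r
... | _ | yes refl | yes refl | _ = r , ≢-sym q≢r , ≢-sym p≢r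

-- The third vertex excludes `K₂`, which is edge-stable but fails `noncritical`.
robust : ∀ (G : Graph n) → Connected G → Equimatchable G → EdgeStable G →
  (∀ u v → ∃ (Avoids u v)) → ∃ (Robust G)
robust G conn equi stable third with saturate G [] (empty G)
... | M₀ , m₀ , _ , _ , sat₀ = length M₀ , record
  { attained = M₀ , m₀ , refl
  ; bound = bound
  ; augment = augment
  ; noncritical = noncritical
  }
  where
  same-size : ∀ {M} → IsMatching G M → Saturated G M → length M ≡ length M₀
  same-size m sat = equi _ _ (saturated⇒maximal G m sat) (saturated⇒maximal G m₀ sat₀)

  bound : ∀ {M} → IsMatching G M → length M ≤ length M₀
  bound m = let N , mN , _ , len , sat = saturate G _ m in ≤-trans len (≤-reflexive (same-size mN sat))

  augment : ∀ {M} → IsMatching G M → length M < length M₀ → ∃₂ λ x y → Adj G x y × Misses M x × Misses M y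
  augment {M} m len with any? (λ x → any? (λ y → adj? G x y ×-dec misses? M x ×-dec misses? M y))
  ... | yes p = p
  ... | no ¬p = ⊥-elim (<-irrefl (same-size m (λ a mx my → ¬p (_ , _ , a , mx , my))) len)

  -- If it failed, `M`, one edge shorter than `M₀`, and `N`, as long as `M₀`, would both be maximal
  -- in `H`.
  noncritical : ∀ {u v M} → IsMatching G ((u , v) ∷ M) → suc (length M) ≡ length M₀ →
    ¬ (∀ w → Misses ((u , v) ∷ M) w → ¬ Adj G u w × ¬ Adj G v w)
  noncritical {u} {v} {M} muv len isolated with uncons G muv
  ... | u~v , Mu , Mv , m = <-irrefl
    (trans (stable (u , v) u~v _ _ (saturated⇒maximal H mH satM) (saturated⇒maximal H mN satN))
      (same-size (All.map proj₁ (proj₁ mN) , proj₂ mN) satN′))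
    (≤-reflexive len)
    where
    H = G ∖ (u , v)

    kept : ∀ {e} → IsEdge G e × (u ≢ proj₁ e × u ≢ proj₂ e) → IsEdge H e
    kept (a , p , q) = a , λ { (inj₁ refl) → p refl ; (inj₂ refl) → q refl }

    mH : IsMatching H M
    mH = All.zipWith kept (proj₁ m , Mu) , proj₂ m

    satM : Saturated H M
    satM {x} {y} (a , ¬uv) mx my with x ≟ u | x ≟ v | y ≟ u | y ≟ v
    ... | yes refl | _ | _ | yes refl = ¬uv (inj₁ refl)
    ... | yes refl | _ | yes refl | _ = irrefl G refl a
    ... | yes refl | _ | no p | no q = proj₁ (isolated y ((p , q) ∷ my)) a
    ... | _ | yes refl | yes refl | _ = ¬uv (inj₂ refl)
    ... | _ | yes refl | _ | yes refl = irrefl G refl a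
    ... | _ | yes refl | no p | no q = proj₂ (isolated y ((p , q) ∷ my)) a
    ... | no p | no q | yes refl | _ = proj₁ (isolated x ((p , q) ∷ mx)) (Adj-sym G a)
    ... | no p | no q | _ | yes refl = proj₂ (isolated x ((p , q) ∷ mx)) (Adj-sym G a)
    -- An edge avoiding `u` and `v` would enlarge the maximum matching `(u , v) ∷ M`.
    ... | no p | no q | no r | no s = <-irrefl refl
      (≤-trans (≤-reflexive (cong suc (sym len))) (bound (insert G a ((p , q) ∷ mx) ((r , s) ∷ my) muv)))

    -- By connectivity some edge yw meets uv in y alone; a maximal matching of
    -- G ∖ uv covering y is maximal in G.
    leaving : ∃₂ λ y w → Touches y (u , v) × ¬ Touches w (u , v) × Adj G y w
    leaving =
      let t , t≢u , t≢v = third u v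
      in exit G (λ x → x ≟ u ⊎-dec x ≟ v) (inj₁ refl) [ t≢u , t≢v ]′ (conn u t)

    y w : Fin _
    y = proj₁ leaving
    w = proj₁ (proj₂ leaving)

    y∈uv : Touches y (u , v)
    y∈uv = proj₁ (proj₂ (proj₂ leaving))

    w∉uv : ¬ Touches w (u , v)
    w∉uv = proj₁ (proj₂ (proj₂ (proj₂ leaving)))

    y~w : Adj H y w
    y~w = proj₂ (proj₂ (proj₂ (proj₂ leaving))) , λ p → w∉uv (≈-touches p (inj₂ refl))

    extension : ∃ λ N → IsMatching H N × ¬ Misses N y × Saturated H N
    extension =
      let N , mN , back , _ , sat = saturate H ((y , w) ∷ []) (insert H y~w [] [] (empty H))
      in N , mN , (λ Ny → proj₁ (All.head (back Ny)) refl) , sat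

    N : List (Pair _)
    N = proj₁ extension

    mN : IsMatching H N
    mN = proj₁ (proj₂ extension)

    ¬Ny : ¬ Misses N y
    ¬Ny = proj₁ (proj₂ (proj₂ extension))

    satN : Saturated H N
    satN = proj₂ (proj₂ (proj₂ extension))

    satN′ : Saturated G N
    satN′ {x} {z} a Nx Nz = case (x , z) ≈? (u , v) of λ where
      (no ¬p) → satN (a , ¬p) Nx Nz
      (yes p) → case ≈-touches (≈-sym p) y∈uv of λ where
        (inj₁ y≡x) → ¬Ny (subst (Misses N) (sym y≡x) Nx)
        (inj₂ y≡z) → ¬Ny (subst (Misses N) (sym y≡z) Nz)

-- Two-colourings from a vertex class.

-- Allows the theorem to be proved under double negation, where essentiality, a statement about all
-- matchings, may be taken to be decidable.
bipartite? : ∀ (G : Graph n) → Dec (Bipartite G)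
bipartite? G = anySubset? λ A → independent? A ×-dec independent? (∁ A)
  where
  independent? : ∀ A → Dec (Independent G A)
  independent? A = map′ (λ f {u} {v} → f u v) (λ f u v → f {u} {v})
    (all? λ u → all? λ v → u ∈? A →-dec v ∈? A →-dec ¬? (adj? G u v))

crossing⇒bipartite : ∀ (G : Graph n) {P : Pred (Fin n) 0ℓ} → Decidable P →
  (∀ {u v} → P u → P v → ¬ Adj G u v) → (∀ {u v} → ¬ P u → ¬ P v → ¬ Adj G u v) → Bipartite G
crossing⇒bipartite {n} G {P} P? ind coind = A ,
  (λ i j → ind (∈A⇒P i) (∈A⇒P j)) ,
  (λ i j → coind (x∈∁p⇒x∉p i ∘ P⇒∈A) (x∈∁p⇒x∉p j ∘ P⇒∈A))
  where
  A = tabulate (does ∘ P?)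

  ∈A⇒P : ∀ {v} → v ∈ˢ A → P v
  ∈A⇒P {v} i with P? v | trans (sym (lookup∘tabulate (does ∘ P?) v)) ([]=⇒lookup i)
  ... | yes p | _ = p

  P⇒∈A : ∀ {v} → P v → v ∈ˢ A
  P⇒∈A {v} p = lookup⇒[]= v A (trans (lookup∘tabulate (does ∘ P?) v) (dec-true (P? v) p))

-- Along a walk from `s` every vertex either has `P` or has all its neighbours in `P`. Hence two
-- adjacent vertices cannot both lack `P`.
propagate : ∀ (G : Graph n) → Connected G → {P : Pred (Fin n) 0ℓ} → Decidable P →
  (∀ {u v} → P u → P v → ¬ Adj G u v) → (∀ {u v w} → P u → Adj G u v → Adj G v w → P w) →
  ∀ s → P s ⊎ (∀ {w} → Adj G s w → P w) → Bipartite G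
propagate G conn {P} P? ind step₂ s start = crossing⇒bipartite G P? ind
  λ {u} ¬pu ¬pv a → [ ¬pu , (λ f → ¬pv (f a)) ]′ (walk start (conn s u))
  where
  walk : ∀ {u v} → P u ⊎ (∀ {w} → Adj G u w → P w) → Star (Adj G) u v → P v ⊎ (∀ {w} → Adj G v w → P w)
  walk i        ε        = i
  walk (inj₁ p) (a ◅ as) = walk (inj₂ (step₂ p a)) as
  walk (inj₂ f) (a ◅ as) = walk (inj₁ (f a)) as

-- Robustness of the parts at a cut vertex.

-- Vertices outside `S` are kept as isolated ones, so the same lists of pairs serve as matchings of
-- `G` without relabelling.
induced : ∀ (G : Graph n) {S : Pred (Fin n) 0ℓ} → Decidable S → Graph n
induced G {S} S? = record
  { Adj    = λ u v → Adj G u v × S u × S v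
  ; adj?   = λ u v → adj? G u v ×-dec S? u ×-dec S? v
  ; sym    = λ (a , p , q) → Adj-sym G a , q , p
  ; irrefl = λ p (a , _) → irrefl G p a
  }

-- A union of components of `G - c`. The neighbour `out` of `c` lies elsewhere, so `c` can be
-- matched without using a vertex of `S`.
record Side (G : Graph n) (c : Fin n) : Set₁ where
  field
    S      : Pred (Fin n) 0ℓ
    S?     : Decidable S
    c∉S    : ¬ S c
    closed : ∀ {u v} → S u → Adj G u v → v ≢ c → S v
    out    : Fin n
    out∉S  : ¬ S out
    c~out  : Adj G c out

  part : Graph n
  part = induced G S?

module _ {G : Graph n} {ν : ℕ} (rob : Robust G ν) {c : Fin n} (side : Side G c)
         {N : List (Pair n)} (mN : IsMatching G N) (lenN : length N ≡ ν) (Nc : Misses N c) where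
  open Robust rob
  open Side side

  part-misses : ∀ {M v} → IsMatching part M → ¬ S v → Misses M v
  part-misses (es , _) ¬sv = All.map (λ (_ , sx , sy) → (λ { refl → ¬sv sx }) , (λ { refl → ¬sv sy })) es

  glue : ∀ {A K} → IsMatching part A → IsMatching G K → (∀ {v} → S v → Misses K v) → IsMatching G (A ++ K)
  glue {[]} mA mK sK = mK
  glue {e ∷ A} mA mK sK with uncons part mA
  ... | (a , sx , sy) , Ax , Ay , mA′ =
    insert G a (All.++⁺ Ax (sK sx)) (All.++⁺ Ay (sK sy)) (glue mA′ mK sK)

  -- As `M` misses `c`, `closed` puts both ends of each edge in `S` or both outside.
  split : ∀ M → IsMatching G M → Misses M c → ∃₂ λ A R → IsMatching part A × IsMatching G R ×
    (∀ {v} → S v → Misses R v) × (∀ {v} → Misses M v → Misses A v × Misses R v) ×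
    length A + length R ≡ length M
  split [] m Mc = [] , [] , empty part , empty G , (λ _ → []) , (λ _ → [] , []) , refl
  split ((x , y) ∷ M) m ((c≢x , c≢y) ∷ Mc) with uncons G m
  ... | a , Mx , My , m′ with split M m′ Mc | S? x
  ... | A , R , mA , mR , sR , sub , len | yes sx =
    (x , y) ∷ A , R ,
    insert part (a , sx , closed sx a (≢-sym c≢y)) (proj₁ (sub Mx)) (proj₁ (sub My)) mA ,
    mR , sR , (λ { (p ∷ q) → p ∷ proj₁ (sub q) , proj₂ (sub q) }) , cong suc len
  ... | A , R , mA , mR , sR , sub , len | no ¬sx =
    A , (x , y) ∷ R , mA ,
    insert G a (proj₂ (sub Mx)) (proj₂ (sub My)) mR ,
    (λ sv → ((λ { refl → ¬sx sv }) , (λ { refl → ¬sx (closed sv (Adj-sym G a) (≢-sym c≢x)) })) ∷ sR sv) ,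
    (λ { (p ∷ q) → proj₁ (sub q) , p ∷ proj₂ (sub q) }) , trans (+-suc _ _) (cong suc len)

  -- Appending `R` or `K` turns a matching of the part with `length A` edges into a maximum matching
  -- of `G`, so properties of `G` descend to the part.
  part-robust : ∃ λ μ → Robust part μ × (∀ {x} → S x → Adj G c x → Essential part μ x)
                  × (∀ {x} → Essential part μ x → S x)
  part-robust with split N mN Nc
  ... | A , R , mA , mR , sR , sub , lenAR = goal
    where
    size : ∀ {B : List (Pair n)} {K : List (Pair n)} → length B ≡ length A → length K ≡ length R → length (B ++ K) ≡ ν
    size {B} {K} p q rewrite length-++ B {K} | p | q = trans lenAR lenN

    -- Otherwise `A ++ R`, a maximum matching, would miss the adjacent vertices `c` and `out`.
    ¬R-out : ¬ Misses R out
    ¬R-out Ro = maximum⇒saturated (glue mA mR sR) (size {A} {R} refl refl) c~out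
      (All.++⁺ (proj₁ (sub Nc)) (proj₂ (sub Nc))) (All.++⁺ (part-misses mA out∉S) Ro)

    goal : ∃ λ μ → Robust part μ × (∀ {x} → S x → Adj G c x → Essential part μ x)
                  × (∀ {x} → Essential part μ x → S x)
    goal with pull G R mR ¬R-out
    ... | y , R′ , mR′ , lenR , to with uncons G mR′ | to (proj₂ (sub Nc))
    ... | _ , R′o , _ , m′ | _ ∷ R′c = length A , record
      { attained = A , mA , refl
      ; bound = bound′
      ; augment = augment′
      ; noncritical = noncritical′
      } , essential-c , essential⇒S
      where
      -- K avoids S as R does but covers c, so completing a matching of the part by K
      -- leaves no vertex outside S that is both missed and adjacent to S.
      K = (c , out) ∷ R′

      mK : IsMatching G K
      mK = insert G c~out R′c R′o m′

      sK : ∀ {v} → S v → Misses K v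
      sK sv = case to (sR sv) of λ { ((p , _) ∷ q) → ((λ v≡c → c∉S (subst S v≡c sv)) , p) ∷ q }

      size-K : ∀ {B : List (Pair n)} → length B ≡ length A → length (B ++ K) ≡ ν
      size-K {B} p = size {B} {K} p (sym lenR)

      K-covers-c : ∀ (B : List (Pair n)) → ¬ Misses (B ++ K) c
      K-covers-c B m = proj₁ (All.head (All.++⁻ʳ B m)) refl

      bound′ : ∀ {M} → IsMatching part M → length M ≤ length A
      bound′ {M} m = +-cancelʳ-≤ (length R) (length M) (length A) (≤-trans (≤-reflexive (sym (length-++ M)))
        (≤-trans (bound (glue m mR sR)) (≤-reflexive (sym (trans lenAR lenN)))))

      augment′ : ∀ {M} → IsMatching part M → length M < length A →
        ∃₂ λ x y → Adj part x y × Misses M x × Misses M y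
      augment′ {M} m lt with augment (glue m mK sK)
        (≤-trans (≤-reflexive (cong suc (length-++ M)))
          (≤-trans (+-monoˡ-< (length K) lt) (≤-reflexive (trans (sym (length-++ A)) (size-K {A} refl)))))
      ... | x , z , x~z , mx , mz with S? x | S? z
      ... | yes sx | yes sz = x , z , (x~z , sx , sz) , All.++⁻ˡ M mx , All.++⁻ˡ M mz
      ... | yes sx | no ¬sz = ⊥-elim (¬sz (closed sx x~z λ { refl → K-covers-c M mz }))
      ... | no ¬sx | yes sz = ⊥-elim (¬sx (closed sz (Adj-sym G x~z) λ { refl → K-covers-c M mx }))
      -- Both ends lie outside `S`, so the maximum matching `A ++ K` misses them too.
      ... | no ¬sx | no ¬sz = ⊥-elim (maximum⇒saturated (glue mA mK sK) (size-K {A} refl) x~z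
        (All.++⁺ (part-misses mA ¬sx) (All.++⁻ʳ M mx)) (All.++⁺ (part-misses mA ¬sz) (All.++⁻ʳ M mz)))

      noncritical′ : ∀ {u v M} → IsMatching part ((u , v) ∷ M) → suc (length M) ≡ length A →
        ¬ (∀ w → Misses ((u , v) ∷ M) w → ¬ Adj part u w × ¬ Adj part v w)
      noncritical′ {u} {v} {M} m len isolated with uncons part m
      ... | (_ , su , sv) , _ = noncritical (glue m mK sK) (size-K {(u , v) ∷ M} len) λ w mw →
        -- `K` covers `c`, so a missed neighbour of `u` or `v` is not `c` and stays in `S`.
        let sw : ∀ {z} → S z → Adj G z w → S w
            sw sz a = closed sz a λ { refl → K-covers-c ((u , v) ∷ M) mw }
            ¬u , ¬v = isolated w (All.++⁻ˡ ((u , v) ∷ M) mw)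
        in (λ a → ¬u (a , su , sw su a)) , (λ a → ¬v (a , sv , sw sv a))

      -- `R`, unlike `K`, misses `c`: if `M` missed `x`, the edge cx could be added to `M ++ R`.
      essential-c : ∀ {x} → S x → Adj G c x → Essential part (length A) x
      essential-c sx a {M} m len Mx = maximum⇒saturated (glue m mR sR) (size {M} {R} len refl) a
        (All.++⁺ (part-misses m c∉S) (proj₂ (sub Nc))) (All.++⁺ Mx (sR sx))

      essential⇒S : ∀ {x} → Essential part (length A) x → S x
      essential⇒S {x} ess with S? x
      ... | yes sx = sx
      ... | no ¬sx = ⊥-elim (ess mA refl (part-misses mA ¬sx))

-- Separation at the cut vertex.

¬¬-∀ : {P : Fin n → Set} → (∀ v → ¬ ¬ P v) → ¬ ¬ (∀ v → P v)
¬¬-∀ = sequence (RawMonad.rawApplicative ¬¬-Monad)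

¬¬-decidable : (P : Fin n → Set) → ¬ ¬ (∀ v → Dec (P v))
¬¬-decidable P = ¬¬-∀ λ v → ¬¬-excluded-middle

record Separation (G : Graph n) (c : Fin n) : Set₁ where
  field
    left right : Side G c
    covers     : ∀ {v} → v ≢ c → Side.S left v ⊎ Side.S right v
    disjoint   : ∀ {v} → Side.S left v → ¬ Side.S right v

  -- The two outer neighbours of `c` differ, since a vertex other than `c` cannot lie outside both
  -- sides.
  three-vertices : ∀ u v → ∃ (Avoids u v)
  three-vertices = avoid (Adj⇒≢ G (c~out left)) (Adj⇒≢ G (c~out right)) λ p →
    [ out∉S left , (λ q → out∉S right (subst (S right) p q)) ]′ (covers (≢-sym (Adj⇒≢ G (c~out left))))
    where open Side

-- The sides are the component of `u` in `G - c` and the remaining vertices other than `c`; each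
-- supplies the outer neighbour of the other.
separate : ∀ (G : Graph (suc n)) {c u v} → Connected G → ¬ Star (Adj (G - c)) u v →
  Decidable (λ w → ∃ λ j → punchIn c j ≡ w × Star (Adj (G - c)) u j) → Separation G c
separate G {c} {u} {v} conn ¬uv S? = record
  { left = record
    { S = S ; S? = S? ; c∉S = c∉S ; closed = closed
    ; out = proj₁ fromR ; out∉S = proj₁ (proj₂ fromR) ; c~out = proj₂ (proj₂ fromR) }
  ; right = record
    { S = R ; S? = R? ; c∉S = c∉R
    ; closed = λ (x≢c , ¬sx) a y≢c → y≢c , λ sy → ¬sx (closed sy (Adj-sym G a) x≢c)
    ; out = proj₁ fromS ; out∉S = (λ (_ , ¬s) → ¬s (proj₁ (proj₂ fromS))) ; c~out = proj₂ (proj₂ fromS) }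
  ; covers = λ {w} w≢c → case S? w of λ where
      (yes sw) → inj₁ sw
      (no ¬sw) → inj₂ (w≢c , ¬sw)
  ; disjoint = λ sw (_ , ¬sw) → ¬sw sw
  }
  where
  S R : Pred (Fin _) 0ℓ
  S w = ∃ λ j → punchIn c j ≡ w × Star (Adj (G - c)) u j
  R w = w ≢ c × ¬ S w

  R? : Decidable R
  R? w = ¬? (w ≟ c) ×-dec ¬? (S? w)

  c∉S : ¬ S c
  c∉S (j , p , _) = punchInᵢ≢i c j p

  c∉R : ¬ R c
  c∉R (c≢c , _) = c≢c refl

  closed : ∀ {x y} → S x → Adj G x y → y ≢ c → S y
  closed (j , refl , path) a y≢c =
    punchOut (≢-sym y≢c) , punchIn-punchOut (≢-sym y≢c) ,
    path ◅◅ (subst (Adj G (punchIn c j)) (sym (punchIn-punchOut (≢-sym y≢c))) a ◅ ε)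

  -- A walk from `S` to `c` must leave `S`, and by `closed` it can do so only at `c`.
  fromS : ∃ λ x → S x × Adj G c x
  fromS with exit G S? (u , refl , ε) c∉S (conn (punchIn c u) c)
  ... | x , y , sx , ¬sy , a with y ≟ c
  ... | yes refl = x , sx , Adj-sym G a
  ... | no y≢c = ⊥-elim (¬sy (closed sx a y≢c))

  v∈R : R (punchIn c v)
  v∈R = punchInᵢ≢i c v , λ (j , p , path) → ¬uv (subst (Star (Adj (G - c)) u) (punchIn-injective c j v p) path)

  fromR : ∃ λ x → ¬ S x × Adj G c x
  fromR with exit G R? v∈R c∉R (conn (punchIn c v) c)
  ... | x , y , (x≢c , ¬sx) , ¬ry , a with y ≟ c
  ... | yes refl = x , ¬sx , Adj-sym G a
  ... | no y≢c = ⊥-elim (¬ry (y≢c , λ sy → ¬sx (closed sy (Adj-sym G a) x≢c)))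

-- A cut vertex does not directly provide an unconnected pair. Without a separation no pair is
-- unconnected, and finiteness moves the double negation outside the quantifiers, against `cut`.
¬¬-separation : ∀ (G : Graph (suc n)) {c} → Connected G → IsCutVertex G c → ¬ ¬ Separation G c
¬¬-separation G conn cut ¬sep = ¬¬-∀ (λ u → ¬¬-∀ λ v ¬uv → ¬¬-decidable _ (¬sep ∘ separate G conn ¬uv)) cut

-- The inessential cut vertex and the conclusion.

¬¬-bipartite-inessential : ∀ {G : Graph n} {ν} → Connected G → Robust G ν → ∀ {c} → Separation G c →
  ∀ {N} → IsMatching G N → length N ≡ ν → Misses N c → ¬ ¬ Bipartite G
¬¬-bipartite-inessential {G = G} conn rob {c} sep mN lenN Nc ¬bip
  with part-robust rob (Separation.left sep) mN lenN Nc | part-robust rob (Separation.right sep) mN lenN Nc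
... | μ₁ , rob₁ , near₁ , within₁ | μ₂ , rob₂ , near₂ , within₂ =
  ¬¬-decidable P λ P? → ¬bip (propagate G conn P? independent step₂ c (inj₂ near))
  where
  open Separation sep
  open Side

  P : Pred (Fin _) 0ℓ
  P v = Essential (part left) μ₁ v ⊎ Essential (part right) μ₂ v

  near : ∀ {x} → Adj G c x → P x
  near a with covers (≢-sym (Adj⇒≢ G a))
  ... | inj₁ s = inj₁ (near₁ s a)
  ... | inj₂ s = inj₂ (near₂ s a)

  across : ∀ {u v} → S left u → S right v → ¬ Adj G u v
  across su sv a = disjoint (closed left su a λ { refl → c∉S right sv }) sv

  independent : ∀ {u v} → P u → P v → ¬ Adj G u v
  independent (inj₁ eu) (inj₁ ev) a = essential-independent rob₁ eu ev (a , within₁ eu , within₁ ev)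
  independent (inj₁ eu) (inj₂ ev) a = across (within₁ eu) (within₂ ev) a
  independent (inj₂ eu) (inj₁ ev) a = across (within₁ ev) (within₂ eu) (Adj-sym G a)
  independent (inj₂ eu) (inj₂ ev) a = essential-independent rob₂ eu ev (a , within₂ eu , within₂ ev)

  inside : ∀ side {u v w} → S side u → Adj G u v → v ≢ c → Adj G v w → w ≢ c →
    Adj (part side) u v × Adj (part side) v w
  inside side su a v≢c b w≢c =
    let sv = closed side su a v≢c in (a , su , sv) , (b , sv , closed side sv b w≢c)

  step₂ : ∀ {u v w} → P u → Adj G u v → Adj G v w → P w
  step₂ {u} {v} {w} pu a b with v ≟ c | w ≟ c
  ... | yes refl | _ = near b
  -- As a neighbour of `c`, `v` would have `P` while adjacent to `u`.
  ... | no _ | yes refl = ⊥-elim (independent pu (near (Adj-sym G b)) a)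
  step₂ (inj₁ eu) a b | no v≢c | no w≢c =
    let a′ , b′ = inside left (within₁ eu) a v≢c b w≢c in inj₁ (essential-step₂ rob₁ eu a′ b′)
  step₂ (inj₂ eu) a b | no v≢c | no w≢c =
    let a′ , b′ = inside right (within₂ eu) a v≢c b w≢c in inj₂ (essential-step₂ rob₂ eu a′ b′)

theorem4p1 : ∀ (n : ℕ) (G : Graph n) → Connected G → Equimatchable G → EdgeStable G → (∃[ v ] IsCutVertex G v) → Bipartite G
theorem4p1 (suc n) G conn equi stable (c , cut) = decidable-stable (bipartite? G) λ ¬bip →
  ¬¬-separation G conn cut λ sep →
    let ν , rob = robust G conn equi stable (Separation.three-vertices sep) in
    ¬¬-decidable (Essential G ν) λ ess? → case ess? c of λ where
      (yes ess) → ¬bip (propagate G conn ess? (essential-independent rob) (essential-step₂ rob) c (inj₁ ess))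
      -- `¬ess` gives no witness, but the goal is empty, so refuting every maximum matching that
      -- misses `c` suffices.
      (no ¬ess) → ¬ess λ mN lenN Nc → ¬¬-bipartite-inessential conn rob sep mN lenN Nc ¬bip
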